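{- For every $n$-HCFP $\mathcal{H}$ and all regular sets $S$ and $C$ of $n$-stores, the set $\mathit{pre}^*_{\mathcal{H}}[C](S)$ is regular, and a finite automaton recognizing it is effectively computable from $\mathcal{H}$ and finite automata recognizing $S$ and $C$.
   Context: Higher-order stores over a finite alphabet $\Gamma$: a 1-store is a sequence $[a_1\ldots a_l]$, $a_i\in\Gamma$, $l\ge0$; for $n\ge2$ an $n$-store is a nonempty sequence $[s_1\ldots s_l]$ of $(n-1)$-stores. An $n$-store is identified with its word $w(s)=[w(s_1)\ldots w(s_l)]$ over $\Gamma'=\Gamma\cup\{[,]\}$; a set of $n$-stores is regular if its set of words is accepted by a finite automaton over $\Gamma'$. Operations: on 1-stores, $\mathit{push}_1^w([a_1\ldots a_l])=[w a_2\ldots a_l]$ for $w\in\Gamma^*$ and $\mathit{top}_1([a_1\ldots a_l])=a_1$ (defined only when $l\ge1$). On $n$-stores $s=[s_1\ldots s_l]$, $n>1$: $\mathit{push}_1^w(s)=[\mathit{push}_1^w(s_1)\,s_2\ldots s_l]$; for $2\le k<n$, $\mathit{push}_k(s)=[\mathit{push}_k(s_1)\,s_2\ldots s_l]$ and $\mathit{pop}_k(s)=[\mathit{pop}_k(s_1)\,s_2\ldots s_l]$; $\mathit{push}_n(s)=[s_1 s_1 s_2\ldots s_l]$; $\mathit{pop}_n(s)=[s_2\ldots s_l]$ if $l>1$, undefined otherwise; $\mathit{top}_k(s)=\mathit{top}_k(s_1)$ for $k<n$, $\mathit{top}_n(s)=s_1$. $O_n=\{\mathit{push}_k,\mathit{pop}_k\mid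 k\in[2,n]\}\cup\{\mathit{push}_1^w\mid w\in\Gamma^*\}$. An $n$-HCFP is $\mathcal{H}=(\Gamma,\Delta)$ with $\Delta\subseteq\Gamma\times O_n$ finite; configurations are $n$-stores, and $s\hookrightarrow s'$ iff there is $(a,o)\in\Delta$ with $\mathit{top}_1(s)=a$ and $s'=o(s)$ (defined). For a set $C$ of $n$-stores, $\hookrightarrow_C=\hookrightarrow\cap(C\times C)$, $\overset{*}{\hookrightarrow}_C$ is its reflexive-transitive closure, and $\mathit{pre}^*_{\mathcal{H}}[C](S)=\{s\mid\exists s'\in S,\ s\overset{*}{\hookrightarrow}_C s'\}$ (so every store along the path, including both endpoints when the path is nonempty, lies in $C$). -}

module Defs where

open import Data.Empty using (⊥)
open import Data.Fin using (Fin)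
open import Data.Fin.Subset using (Subset; _∈_)
open import Data.List using (List; []; _∷_; _++_; map; concatMap; head)
import Data.List.Membership.Propositional as List
open import Data.List.NonEmpty using (List⁺; _∷_; toList)
open import Data.Maybe as Maybe using (Maybe; just; nothing)
open import Data.Nat using (ℕ; zero; suc; _≤_; s≤s; _≤′_; ≤′-reflexive; ≤′-refl; ≤′-step)
open import Data.Product using (∃; ∃₂; _×_; _,_)
open import Function.Bundles using (_↔_; _⇔_)
open import Level using (0ℓ)
open import Relation.Binary.Core using (Rel)
open import Relation.Binary.Construct.Closure.ReflexiveTransitive using (Star)
open import Relation.Binary.PropositionalEquality using (_≡_)
open import Relation.Unary using (Pred)

Finite : Set → Set
Finite A = ∃ λ k → A ↔ Fin k

record NFA (A : Set) : Set where
  field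
    size    : ℕ
    initial : Subset size
    step    : Fin size → A → Subset size
    final   : Subset size

module _ {A : Set} (M : NFA A) where
  open NFA M

  AcceptsFrom : Fin size → List A → Set
  AcceptsFrom q []      = q ∈ final
  AcceptsFrom q (a ∷ u) = ∃ λ r → r ∈ step q a × AcceptsFrom r u

  Accepts : List A → Set
  Accepts u = ∃ λ q → q ∈ initial × AcceptsFrom q u

-- Orders start at 1; there are no 0-stores.
Store : Set → ℕ → Set
Store Γ zero          = ⊥
Store Γ (suc zero)    = List Γ
Store Γ (suc (suc n)) = List⁺ (Store Γ (suc n))

data Bracketed (Γ : Set) : Set where
  sym : Γ → Bracketed Γ
  ⟦ ⟧ : Bracketed Γ

-- The derivation of k ≤′ n counts the n - k levels to descend before an
-- order-k operation acts.
data Op (Γ : Set) (n : ℕ) : Set where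
  push₁    : List Γ → Op Γ n
  push pop : ∀ k → 2 ≤ k → k ≤′ n → Op Γ n

record HCFP (Γ : Set) (n : ℕ) : Set where
  field
    Δ : List (Γ × Op Γ n)

module _ {Γ : Set} where

  word : ∀ n → Store Γ n → List (Bracketed Γ)
  word (suc zero)    as = ⟦ ∷ map sym as ++ ⟧ ∷ []
  word (suc (suc n)) ss = ⟦ ∷ concatMap (word (suc n)) (toList ss) ++ ⟧ ∷ []

  top₁ : ∀ n → Store Γ n → Maybe Γ
  top₁ (suc zero)    as       = head as
  top₁ (suc (suc n)) (s ∷ ss) = top₁ (suc n) s

  applyPush₁ : ∀ n → List Γ → Store Γ n → Maybe (Store Γ n)
  applyPush₁ (suc zero)    w []       = nothing
  applyPush₁ (suc zero)    w (a ∷ as) = just (w ++ as)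
  applyPush₁ (suc (suc n)) w (s ∷ ss) = Maybe.map (_∷ ss) (applyPush₁ (suc n) w s)

  applyPush : ∀ n {k} → 2 ≤ k → k ≤′ n → Store Γ n → Store Γ n
  applyPush (suc zero)    (s≤s ()) ≤′-refl
  applyPush (suc zero)    (s≤s _)  (≤′-step (≤′-reflexive ()))
  applyPush (suc (suc n)) 2≤k      ≤′-refl       (s ∷ ss) = s ∷ s ∷ ss
  applyPush (suc (suc n)) 2≤k      (≤′-step k≤n) (s ∷ ss) = applyPush (suc n) 2≤k k≤n s ∷ ss

  applyPop : ∀ n {k} → 2 ≤ k → k ≤′ n → Store Γ n → Maybe (Store Γ n)
  applyPop (suc zero)    (s≤s ()) ≤′-refl
  applyPop (suc zero)    (s≤s _)  (≤′-step (≤′-reflexive ()))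
  applyPop (suc (suc n)) 2≤k      ≤′-refl       (s ∷ [])     = nothing
  applyPop (suc (suc n)) 2≤k      ≤′-refl       (s ∷ t ∷ ss) = just (t ∷ ss)
  applyPop (suc (suc n)) 2≤k      (≤′-step k≤n) (s ∷ ss)     =
    Maybe.map (_∷ ss) (applyPop (suc n) 2≤k k≤n s)

  apply : ∀ n → Op Γ n → Store Γ n → Maybe (Store Γ n)
  apply n (push₁ w)        s = applyPush₁ n w s
  apply n (push k 2≤k k≤n) s = just (applyPush n 2≤k k≤n s)
  apply n (pop k 2≤k k≤n)  s = applyPop n 2≤k k≤n s

  -- M accepts exactly the words of the stores in S; in particular it rejects
  -- every word that does not encode a store.
  Recognizes : ∀ n → NFA (Bracketed Γ) → Pred (Store Γ n) 0ℓ → Set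
  Recognizes n M S = ∀ u → Accepts M u ⇔ (∃ λ s → S s × word n s ≡ u)

  Regular : ∀ n → Pred (Store Γ n) 0ℓ → Set
  Regular n S = ∃ λ M → Recognizes n M S

  module _ {n : ℕ} (H : HCFP Γ n) where
    open HCFP H

    Step : Rel (Store Γ n) 0ℓ
    Step s s′ = ∃₂ λ a o → (a , o) List.∈ Δ × top₁ n s ≡ just a × apply n o s ≡ just s′

    StepIn : Pred (Store Γ n) 0ℓ → Rel (Store Γ n) 0ℓ
    StepIn C s s′ = Step s s′ × C s × C s′

    pre* : Pred (Store Γ n) 0ℓ → Pred (Store Γ n) 0ℓ → Pred (Store Γ n) 0ℓ
    pre* C S s = ∃ λ s′ → S s′ × Star (StepIn C) s s′

{-# OPTIONS --safe #-}
module Submission where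

-- A system of mutually recursive predicates on stores, given by positive
-- formulas over the store operations, has a regular least solution; pre*[C](S)
-- is one of the predicates of such a system once membership in S and C is
-- checked by predicates that run the two automata on the store while popping
-- it.  Regularity goes by induction on the order.  On a list t ∷ ts, pops look
-- at ts only through the set X of predicates that hold there, so a predicate p
-- splits into predicates [p , X] on the topmost element t, and these satisfy a
-- system of lower order: a duplication of t guesses the set Y of predicates
-- used when the copy is popped, and requires [y , X] of t for every y ∈ Y.
-- An automaton reads a list element by element, chaining the sets X.
-- At order 0 and on the empty list, finitely many propositions remain, and
-- saturation decides them.

open import Defs
open import Data.Bool using (Bool; true; false; T)
open import Data.Bool.Properties using (T?; T-≡)
open import Data.Empty using (⊥; ⊥-elim)
open import Data.Fin using (Fin; zero; suc)
import Data.Fin.Properties as Fin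
open import Data.Fin.Subset as Subset using (Subset; _∈_; _⊆_; _∪_; ⁅_⁆)
open import Data.Fin.Subset.Induction using (⊃-wellFounded)
open import Data.Fin.Subset.Properties using (_∈?_; ∉⊥; x∈⁅x⁆; x∈⁅y⁆⇒x≡y; p⊆p∪q; q⊆p∪q; x∈p∪q⁻)
open import Data.List using (List; []; _∷_; _++_; concatMap; map; lookup)
open import Data.List.Membership.Propositional.Properties using (∈-lookup)
open import Data.List.NonEmpty using (_∷_)
open import Data.List.Properties using (++-assoc; ∷-injective; ∷-injectiveˡ; ∷-injectiveʳ; map-injective)
open import Data.List.Relation.Unary.Any as Any using ()
open import Data.List.Relation.Unary.Any.Properties using (lookup-index)
open import Data.Maybe as Maybe using (Maybe; just)
open import Data.Nat using (ℕ; zero; suc; NonZero; _≤_; s≤s; _≤′_; ≤′-reflexive; ≤′-refl; ≤′-step; ≢-nonZero⁻¹)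
open import Data.Product as Product using (∃; ∃₂; Σ-syntax; _×_; _,_; proj₁; proj₂; -,_)
open import Data.Product.Function.NonDependent.Propositional using (_×-↪_)
open import Data.Sum as Sum using (_⊎_; inj₁; inj₂; [_,_]′)
open import Data.Sum.Function.Propositional using (_⊎-↪_)
open import Data.Unit using (⊤; tt)
open import Data.Vec using ([]; _∷_; tabulate)
open import Data.Vec.Properties using ([]=⇒lookup; lookup⇒[]=; lookup∘tabulate)
open import Function using (_∘_; id)
open import Function.Bundles using (_⇔_; _↪_; mk↪; mk⇔; RightInverse; Equivalence)
open import Function.Construct.Composition using (_↪-∘_)
open import Function.Construct.Identity using (↪-id)
open import Function.Properties.Inverse using (↔⇒↪; ↔-sym)
open import Induction.WellFounded using (Acc; acc)
open import Level using (0ℓ)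
open import Relation.Binary.Construct.Closure.ReflexiveTransitive using (Star; ε; _◅_)
open import Relation.Binary.Definitions using (DecidableEquality)
open import Relation.Binary.PropositionalEquality using (_≡_; refl; cong; cong₂; subst; trans) renaming (sym to ≡-sym)
open import Relation.Nullary using (Dec; yes; no; contradiction)
open import Relation.Nullary.Decidable using (map′; _×-dec_; _⊎-dec_; _→-dec_; ⌊_⌋; toWitness; fromWitness; ¬?; decidable-stable)
open import Relation.Unary using (Pred)

-- Finite types as retracts of `Fin k`.

↪-≟ : ∀ {A : Set} {k} → A ↪ Fin k → DecidableEquality A
↪-≟ e a b = map′ (λ eq → trans (≡-sym (strictlyInverseʳ a)) (trans (cong from eq) (strictlyInverseʳ b)))
  (cong to) (to a Fin.≟ to b)
  where open RightInverse e

↪-× : ∀ {A B : Set} {k l} → A ↪ Fin k → B ↪ Fin l → ∃ λ m → (A × B) ↪ Fin m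
↪-× e f = -, ↔⇒↪ (↔-sym Fin.*↔×) ↪-∘ (e ×-↪ f)

↪-⊎ : ∀ {A B : Set} {k l} → A ↪ Fin k → B ↪ Fin l → ∃ λ m → (A ⊎ B) ↪ Fin m
↪-⊎ e f = -, ↔⇒↪ (↔-sym Fin.+↔⊎) ↪-∘ (e ⊎-↪ f)

Bool↪ : Bool ↪ Fin 2
Bool↪ = ↔⇒↪ (↔-sym Fin.2↔Bool)

Subset↪ : ∀ n → ∃ λ m → Subset n ↪ Fin m
Subset↪ zero    = 1 , mk↪ {to = λ _ → zero} {from = λ _ → []} λ { {[]} _ → refl }
Subset↪ (suc n) = -, proj₂ (↪-× Bool↪ (proj₂ (Subset↪ n))) ↪-∘
  mk↪ {to = λ { (b ∷ p) → b , p }} {from = λ (b , p) → b ∷ p} λ { {b ∷ p} refl → refl }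

-- Trees, actions, and positive formulas with their least solutions.

-- Unlike stores, trees have a height 0 and contain empty lists at all other
-- heights.
Tree : Set → ℕ → Set
Tree Γ zero    = Γ
Tree Γ (suc n) = List (Tree Γ n)

yield  : ∀ {Γ} n → Tree Γ n → List (Bracketed Γ)
yields : ∀ {Γ} n → List (Tree Γ n) → List (Bracketed Γ)
yield zero    a  = sym a ∷ []
yield (suc n) ts = ⟦ ∷ yields n ts
yields n []       = ⟧ ∷ []
yields n (t ∷ ts) = yield n t ++ yields n ts

-- The formulas below allow a shrinking act only directly in front of a
-- predicate, so that its effect is a condition on the tail alone.
data Kind : Set where
  keep shrink : Kind

data Act (Γ : Set) : Kind → ℕ → Set where
  set top : Γ → Act Γ keep 0
  dup nil : ∀ {n} → Act Γ keep (suc n)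
  pop     : ∀ {n} → Act Γ shrink (suc n)
  ↑       : ∀ {n κ} → Act Γ κ n → Act Γ κ (suc n)

-- `top` and `nil` are tests: they leave the tree unchanged and only restrict where a step exists.
data _—[_]→_ {Γ} : ∀ {n κ} → Tree Γ n → Act Γ κ n → Tree Γ n → Set where
  set : ∀ {a b} → _—[_]→_ {n = 0} a (set b) b
  top : ∀ {a} → _—[_]→_ {n = 0} a (top a) a
  dup : ∀ {n} {t : Tree Γ n} {ts} → _—[_]→_ {n = suc n} (t ∷ ts) dup (t ∷ t ∷ ts)
  nil : ∀ {n} → _—[_]→_ {n = suc n} [] nil []
  pop : ∀ {n} {t : Tree Γ n} {ts} → _—[_]→_ {n = suc n} (t ∷ ts) pop ts
  ↑   : ∀ {n κ} {α : Act Γ κ n} {t t′ ts} →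
        t —[ α ]→ t′ → _—[_]→_ {n = suc n} (t ∷ ts) (↑ α) (t′ ∷ ts)

→-deterministic : ∀ {Γ n κ} {α : Act Γ κ n} {t t₁ t₂} → t —[ α ]→ t₁ → t —[ α ]→ t₂ → t₁ ≡ t₂
→-deterministic set set = refl
→-deterministic top top = refl
→-deterministic dup dup = refl
→-deterministic nil nil = refl
→-deterministic pop pop = refl
→-deterministic (↑ s) (↑ s′) = cong (_∷ _) (→-deterministic s s′)

infixr 6 _∧_
infixr 5 _∨_

data Formula (Γ P : Set) (n : ℕ) : Set where
  test    : Bool → Formula Γ P n
  _∧_ _∨_ : Formula Γ P n → Formula Γ P n → Formula Γ P n
  var     : P → Formula Γ P n
  ⟨_⟩_    : Act Γ keep n → Formula Γ P n → Formula Γ P n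
  ⟨_⟩↓_   : Act Γ shrink n → P → Formula Γ P n

⋀ ⋁ : ∀ {Γ P n k} → (Fin k → Formula Γ P n) → Formula Γ P n
⋀ {k = zero}  f = test true
⋀ {k = suc k} f = f zero ∧ ⋀ (f ∘ suc)
⋁ {k = zero}  f = test false
⋁ {k = suc k} f = f zero ∨ ⋁ (f ∘ suc)

Valuation : Set → Set → ℕ → Set₁
Valuation Γ P n = P → Tree Γ n → Set

_⊩[_]_ : ∀ {Γ P n} → Tree Γ n → Valuation Γ P n → Formula Γ P n → Set
t ⊩[ ρ ] test b     = T b
t ⊩[ ρ ] (φ ∧ ψ)    = t ⊩[ ρ ] φ × t ⊩[ ρ ] ψ
t ⊩[ ρ ] (φ ∨ ψ)    = t ⊩[ ρ ] φ ⊎ t ⊩[ ρ ] ψ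
t ⊩[ ρ ] var p      = ρ p t
t ⊩[ ρ ] (⟨ α ⟩ φ)  = ∃ λ t′ → t —[ α ]→ t′ × t′ ⊩[ ρ ] φ
t ⊩[ ρ ] (⟨ α ⟩↓ p) = ∃ λ t′ → t —[ α ]→ t′ × ρ p t′

module _ {Γ P : Set} {n : ℕ} where

  ⊩-⋀⁺ : ∀ {ρ : Valuation Γ P n} {t k} {f : Fin k → Formula Γ P n} → (∀ i → t ⊩[ ρ ] f i) → t ⊩[ ρ ] ⋀ f
  ⊩-⋀⁺ {k = zero}  h = tt
  ⊩-⋀⁺ {k = suc k} h = h zero , ⊩-⋀⁺ (h ∘ suc)

  ⊩-⋀⁻ : ∀ {ρ : Valuation Γ P n} {t k} {f : Fin k → Formula Γ P n} → t ⊩[ ρ ] ⋀ f → ∀ i → t ⊩[ ρ ] f i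
  ⊩-⋀⁻ (x , y) zero    = x
  ⊩-⋀⁻ (x , y) (suc i) = ⊩-⋀⁻ y i

  ⊩-⋁⁺ : ∀ {ρ : Valuation Γ P n} {t k} (f : Fin k → Formula Γ P n) {i} → t ⊩[ ρ ] f i → t ⊩[ ρ ] ⋁ f
  ⊩-⋁⁺ f {zero}  x = inj₁ x
  ⊩-⋁⁺ f {suc i} x = inj₂ (⊩-⋁⁺ (f ∘ suc) x)

  ⊩-⋁⁻ : ∀ {ρ : Valuation Γ P n} {t k} (f : Fin k → Formula Γ P n) → t ⊩[ ρ ] ⋁ f → ∃ λ i → t ⊩[ ρ ] f i
  ⊩-⋁⁻ {k = suc k} f (inj₁ x) = zero , x
  ⊩-⋁⁻ {k = suc k} f (inj₂ x) = Product.map suc id (⊩-⋁⁻ (f ∘ suc) x)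

  ⊩-mono : ∀ {ρ σ : Valuation Γ P n} → (∀ p t → ρ p t → σ p t) →
    ∀ (φ : Formula Γ P n) t → t ⊩[ ρ ] φ → t ⊩[ σ ] φ
  ⊩-mono h (test b) t x = x
  ⊩-mono h (φ ∧ ψ) t (x , y) = ⊩-mono h φ t x , ⊩-mono h ψ t y
  ⊩-mono h (φ ∨ ψ) t = Sum.map (⊩-mono h φ t) (⊩-mono h ψ t)
  ⊩-mono h (var p) t x = h p t x
  ⊩-mono h (⟨ α ⟩ φ) t (t′ , s , x) = t′ , s , ⊩-mono h φ t′ x
  ⊩-mono h (⟨ α ⟩↓ p) t (t′ , s , x) = t′ , s , h p t′ x

  -- The valuation occurs only positively in `⊩`, so the least solution can be an inductive type.
  data μ (rhs : P → Formula Γ P n) (p : P) (t : Tree Γ n) : Set where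
    fold : t ⊩[ μ rhs ] rhs p → μ rhs p t

  μ-rec : ∀ {rhs} {σ : Valuation Γ P n} → (∀ p t → t ⊩[ σ ] rhs p → σ p t) → ∀ p t → μ rhs p t → σ p t
  μ-rec {rhs} {σ} closed = rec
    where
    rec : ∀ p t → μ rhs p t → σ p t
    -- Repeats `⊩-mono` with `rec` inlined, so that the termination checker sees calls on
    -- subderivations.
    rec⊩ : ∀ φ t → t ⊩[ μ rhs ] φ → t ⊩[ σ ] φ
    rec p t (fold x) = closed p t (rec⊩ (rhs p) t x)
    rec⊩ (test b) t x = x
    rec⊩ (φ ∧ ψ) t (x , y) = rec⊩ φ t x , rec⊩ ψ t y
    rec⊩ (φ ∨ ψ) t (inj₁ x) = inj₁ (rec⊩ φ t x)
    rec⊩ (φ ∨ ψ) t (inj₂ x) = inj₂ (rec⊩ ψ t x)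
    rec⊩ (var p) t x = rec p t x
    rec⊩ (⟨ α ⟩ φ) t (t′ , s , x) = t′ , s , rec⊩ φ t′ x
    rec⊩ (⟨ α ⟩↓ p) t (t′ , s , x) = t′ , s , rec p t′ x

-- Deciding least solutions on finite closed sets of trees.

-- `τ` enumerates a finite set of trees that no action leaves. The instances are the letters at
-- height 0 and the set containing only the empty list.
module Saturation {Γ P Z : Set} {n k l : ℕ} (P↪ : P ↪ Fin k) (Z↪ : Z ↪ Fin l)
  (τ : Z → Tree Γ n) (τ-injective : ∀ {z z′} → τ z ≡ τ z′ → z ≡ z′)
  (closed : ∀ {κ} (α : Act Γ κ n) {z t} → τ z —[ α ]→ t → ∃ λ z′ → t ≡ τ z′)
  (step? : ∀ {κ} (α : Act Γ κ n) z → Dec (∃ λ t → τ z —[ α ]→ t))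
  where

  restrict : ∀ {ρ σ : Valuation Γ P n} → (∀ p {z} → ρ p (τ z) → σ p (τ z)) →
    ∀ (φ : Formula Γ P n) {z} → τ z ⊩[ ρ ] φ → τ z ⊩[ σ ] φ
  restrict h (test b) x = x
  restrict h (φ ∧ ψ) (x , y) = restrict h φ x , restrict h ψ y
  restrict h (φ ∨ ψ) = Sum.map (restrict h φ) (restrict h ψ)
  restrict h (var p) x = h p x
  restrict h (⟨ α ⟩ φ) (t , s , x) with closed α s
  ... | _ , refl = t , s , restrict h φ x
  restrict h (⟨ α ⟩↓ p) (t , s , x) with closed α s
  ... | _ , refl = t , s , h p x

  act? : ∀ {κ} (α : Act Γ κ n) {Q : Tree Γ n → Set} → (∀ z → Dec (Q (τ z))) →
    ∀ z → Dec (∃ λ t → τ z —[ α ]→ t × Q t)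
  act? α Q? z with step? α z
  ... | no ¬s = no λ (t , s , _) → ¬s (t , s)
  ... | yes (t , s) with closed α s
  ...   | z′ , refl with Q? z′
  ...     | yes q = yes (t , s , q)
  -- Actions are deterministic, so the failing successor is the only candidate.
  ...     | no ¬q = no λ { (t′ , s′ , q) → ¬q (subst _ (→-deterministic s′ s) q) }

  ⊩? : ∀ {ρ : Valuation Γ P n} → (∀ p z → Dec (ρ p (τ z))) → ∀ φ z → Dec (τ z ⊩[ ρ ] φ)
  ⊩? ρ? (test b) z = T? b
  ⊩? ρ? (φ ∧ ψ) z = ⊩? ρ? φ z ×-dec ⊩? ρ? ψ z
  ⊩? ρ? (φ ∨ ψ) z = ⊩? ρ? φ z ⊎-dec ⊩? ρ? ψ z
  ⊩? ρ? (var p) z = ρ? p z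
  ⊩? ρ? (⟨ α ⟩ φ) z = act? α (⊩? ρ? φ) z
  ⊩? ρ? (⟨ α ⟩↓ p) z = act? α (ρ? p) z

  V↪ : (P × Z) ↪ Fin _
  V↪ = proj₂ (↪-× P↪ Z↪)
  open RightInverse V↪ renaming (to to index; from to elem; strictlyInverseʳ to elem-index)

  module _ (rhs : P → Formula Γ P n) where

    ⟪_⟫ : Subset _ → Valuation Γ P n
    ⟪ X ⟫ p t = ∃ λ z → t ≡ τ z × index (p , z) ∈ X

    ⟪_⟫? : ∀ X p z → Dec (⟪ X ⟫ p (τ z))
    ⟪ X ⟫? p z = map′ (λ x → z , refl , x)
      (λ (z′ , eq , x) → subst (λ z → index (p , z) ∈ X) (≡-sym (τ-injective eq)) x) (index (p , z) ∈? X)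

    Derivable : Subset _ → Set
    Derivable X = ∀ {i} → i ∈ X → let (p , z) = elem i in μ rhs p (τ z)

    -- While some right-hand side holds under the current set and its atom is missing, that atom is
    -- added. The set grows strictly inside a finite one, so this stops at a closed set of derivable
    -- atoms.
    saturate : ∀ X → Acc Subset._⊃_ X → Derivable X →
      ∃ λ X → Derivable X × (∀ {p z} → τ z ⊩[ ⟪ X ⟫ ] rhs p → index (p , z) ∈ X)
    saturate X (acc more) derivable
      with Fin.any? (λ i → ¬? (i ∈? X) ×-dec ⊩? ⟪ X ⟫? (rhs (proj₁ (elem i))) (proj₂ (elem i)))
    ... | yes (i , i∉X , x) = saturate (X ∪ ⁅ i ⁆)
            (more (p⊆p∪q _ , i , q⊆p∪q X _ (x∈⁅x⁆ i) , i∉X)) extended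
      where
      extended : Derivable (X ∪ ⁅ i ⁆)
      extended j∈ with x∈p∪q⁻ X ⁅ i ⁆ j∈
      ... | inj₁ j∈X = derivable j∈X
      ... | inj₂ j∈i rewrite x∈⁅y⁆⇒x≡y i j∈i = fold (⊩-mono
              (λ { p _ (z , refl , y) → subst (λ (p , z) → μ rhs p (τ z)) (elem-index _) (derivable y) })
              (rhs (proj₁ (elem i))) _ x)
    ... | no ¬new = X , derivable , λ {p} {z} x → decidable-stable (_ ∈? X) λ ∉X →
            ¬new (index (p , z) , ∉X ,
              subst (λ (p , z) → τ z ⊩[ ⟪ X ⟫ ] rhs p) (≡-sym (elem-index (p , z))) x)

    μ? : ∀ p z → Dec (μ rhs p (τ z))
    μ? p z with saturate Subset.⊥ (⊃-wellFounded _) (λ i∈⊥ → contradiction i∈⊥ ∉⊥)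
    ... | X , derivable , saturated = map′
      (λ x → subst (λ (p , z) → μ rhs p (τ z)) (elem-index _) (derivable x))
      -- Trees outside the image of `τ` satisfy this valuation vacuously; `restrict` discards them,
      -- since actions stay in the image.
      (λ x → μ-rec {σ = λ p t → ∀ z → t ≡ τ z → index (p , z) ∈ X}
        (λ { p _ x z refl → saturated (restrict (λ p {z} y → z , refl , y z refl) (rhs p) x) }) p _ x z refl)
      (index (p , z) ∈? X)

-- Lowering the height of a system by one.

-- The predicate (Y , X) on t stands for the conjunction of the [p , X] with
-- p ∈ Y: whenever ts satisfies all of X, t ∷ ts satisfies all of Y.
module Descent {Γ P : Set} {n k : ℕ} (P↪ : P ↪ Fin k) (rhs : P → Formula Γ P (suc n)) where

  open RightInverse P↪ renaming (to to index; from to elem; strictlyInverseʳ to elem-index)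
  open RightInverse (proj₂ (Subset↪ k)) using ()
    renaming (to to subsetIndex; from to subset; strictlyInverseʳ to subset-subsetIndex)

  P′ : Set
  P′ = Subset k × Subset k

  P′↪ : ∃ λ m → P′ ↪ Fin m
  P′↪ = ↪-× (proj₂ (Subset↪ k)) (proj₂ (Subset↪ k))

  -- `X` describes the tail below `t`. `nil` fails because the list contains `t`; `pop` exposes
  -- exactly the tail, so `X` answers it. Only `dup` changes the tail, which becomes `t ∷ ts` and is
  -- described by the guessed set.
  tr : Formula Γ P (suc n) → Subset k → Formula Γ P′ n
  tr (test b)       X = test b
  tr (φ ∧ ψ)        X = tr φ X ∧ tr ψ X
  tr (φ ∨ ψ)        X = tr φ X ∨ tr ψ X
  tr (var p)        X = var (⁅ index p ⁆ , X)
  tr (⟨ dup ⟩ φ)    X = ⋁ λ j → tr φ (subset j) ∧ var (subset j , X)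
  tr (⟨ nil ⟩ φ)    X = test false
  tr (⟨ ↑ α ⟩ φ)    X = ⟨ α ⟩ tr φ X
  tr (⟨ pop ⟩↓ p)   X = test ⌊ index p ∈? X ⌋
  tr (⟨ ↑ α ⟩↓ p)   X = ⟨ α ⟩↓ (⁅ index p ⁆ , X)

  -- The test that `i` is outside `Y` is an escape that restricts the conjunction over all of
  -- `Fin k` to `Y`.
  rhs′ : P′ → Formula Γ P′ n
  rhs′ (Y , X) = ⋀ λ i → test ⌊ ¬? (i ∈? Y) ⌋ ∨ tr (rhs (elem i)) X

  rhs′⁺ : ∀ {ρ : Valuation Γ P′ n} {Y X t} →
    (∀ {i} → i ∈ Y → t ⊩[ ρ ] tr (rhs (elem i)) X) → t ⊩[ ρ ] rhs′ (Y , X)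
  rhs′⁺ {ρ} {Y} {X} {t} h = ⊩-⋀⁺ λ i → side i
    where
    side : ∀ i → t ⊩[ ρ ] (test ⌊ ¬? (i ∈? Y) ⌋ ∨ tr (rhs (elem i)) X)
    side i with i ∈? Y
    ... | yes i∈Y = inj₂ (h i∈Y)
    ... | no  i∉Y = inj₁ tt

  rhs′⁻ : ∀ {ρ : Valuation Γ P′ n} {Y X t} → t ⊩[ ρ ] rhs′ (Y , X) →
    ∀ {i} → i ∈ Y → t ⊩[ ρ ] tr (rhs (elem i)) X
  rhs′⁻ {Y = Y} x {i} i∈Y with i ∈? Y | ⊩-⋀⁻ x i
  ... | yes _   | inj₂ y = y
  ... | no  i∉Y | _      = contradiction i∈Y i∉Y

  _⊨_ : Tree Γ (suc n) → Subset k → Set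
  ts ⊨ X = ∀ {i} → i ∈ X → μ rhs (elem i) ts

  ⊨-⁅⁆ : ∀ {p ts} → μ rhs p ts → ts ⊨ ⁅ index p ⁆
  ⊨-⁅⁆ {p} x i∈ rewrite x∈⁅y⁆⇒x≡y (index p) i∈ | elem-index p = x

  ⊨-index : ∀ {p ts X} → ts ⊨ X → index p ∈ X → μ rhs p ts
  ⊨-index {ts = ts} h p∈X = subst (λ p → μ rhs p ts) (elem-index _) (h p∈X)

  Extends : Valuation Γ P′ n
  Extends (Y , X) t = ∀ ts → ts ⊨ X → (t ∷ ts) ⊨ Y

  tr-sound : ∀ φ {X t ts} → t ⊩[ Extends ] tr φ X → ts ⊨ X → (t ∷ ts) ⊩[ μ rhs ] φ
  tr-sound (test b) x h = x
  tr-sound (φ ∧ ψ) (x , y) h = tr-sound φ x h , tr-sound ψ y h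
  tr-sound (φ ∨ ψ) (inj₁ x) h = inj₁ (tr-sound φ x h)
  tr-sound (φ ∨ ψ) (inj₂ x) h = inj₂ (tr-sound ψ x h)
  tr-sound (var p) x h = ⊨-index (x _ h) (x∈⁅x⁆ _)
  tr-sound (⟨ dup ⟩ φ) {X} x h with ⊩-⋁⁻ (λ j → tr φ (subset j) ∧ var (subset j , X)) x
  -- `z` makes the lower copy on top of `ts` satisfy the guessed set, which is what `y` assumes of
  -- its tail.
  ... | j , y , z = -, dup , tr-sound φ y (z _ h)
  tr-sound (⟨ ↑ α ⟩ φ) (_ , s , x) h = -, ↑ s , tr-sound φ x h
  tr-sound (⟨ pop ⟩↓ p) {X} x h = -, pop , ⊨-index h (toWitness x)
  tr-sound (⟨ ↑ α ⟩↓ p) (_ , s , x) h = -, ↑ s , ⊨-index (x _ h) (x∈⁅x⁆ _)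

  μ′-sound : ∀ q {t} → μ rhs′ q t → Extends q t
  μ′-sound q x = μ-rec {σ = Extends}
    (λ { (Y , X) t x ts h i∈Y → fold (tr-sound (rhs (elem _)) (rhs′⁻ {Y = Y} x i∈Y) h) }) q _ x

  -- Upward closure in X makes runs closed under unions.
  Run : Tree Γ (suc n) → Subset k → Set
  Run []       Y = [] ⊨ Y
  Run (t ∷ ts) Y = ∃ λ X → Run ts X × (∀ {X′} → X ⊆ X′ → μ rhs′ (Y , X′) t)

  Run-∪ : ∀ ts {Y Z} → Run ts Y → Run ts Z → Run ts (Y ∪ Z)
  Run-∪ [] {Y} {Z} x y i∈ = [ x , y ]′ (x∈p∪q⁻ Y Z i∈)
  Run-∪ (t ∷ ts) {Y} {Z} (X₁ , r₁ , h₁) (X₂ , r₂ , h₂) = X₁ ∪ X₂ , Run-∪ ts r₁ r₂ ,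
    λ X⊆ → fold (rhs′⁺ ([ rhs′⁻ (unfold (h₁ (X⊆ ∘ p⊆p∪q X₂))) , rhs′⁻ (unfold (h₂ (X⊆ ∘ q⊆p∪q X₁ X₂))) ]′
      ∘ x∈p∪q⁻ Y Z))
    where
    unfold : ∀ {q t} → μ rhs′ q t → t ⊩[ μ rhs′ ] rhs′ q
    unfold (fold x) = x

  -- Strengthened induction hypothesis: a run on a nonempty list is assembled from runs of the
  -- premises, whereas on the empty list truth in the least solution is itself the run.
  Derived : Valuation Γ P (suc n)
  Derived p ts = μ rhs p ts × Run ts ⁅ index p ⁆

  -- `X` collects what the formula asks of the tail: nothing for a test, a union for a conjunction,
  -- a singleton for a pop.
  tr-complete : ∀ φ {t ts} → (t ∷ ts) ⊩[ Derived ] φ →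
    ∃ λ X → Run ts X × (∀ {X′} → X ⊆ X′ → t ⊩[ μ rhs′ ] tr φ X′)
  tr-complete (test b) {ts = ts} x = Subset.⊥ , Run-⊥ ts , λ _ → x
    where
    Run-⊥ : ∀ ts → Run ts Subset.⊥
    Run-⊥ []       i∈⊥ = contradiction i∈⊥ ∉⊥
    Run-⊥ (t ∷ ts) = Subset.⊥ , Run-⊥ ts , λ _ → fold (rhs′⁺ (λ i∈⊥ → contradiction i∈⊥ ∉⊥))
  tr-complete (φ ∧ ψ) {ts = ts} (x , y) with tr-complete φ x | tr-complete ψ y
  ... | X₁ , r₁ , h₁ | X₂ , r₂ , h₂ =
    X₁ ∪ X₂ , Run-∪ ts r₁ r₂ , λ X⊆ → h₁ (X⊆ ∘ p⊆p∪q X₂) , h₂ (X⊆ ∘ q⊆p∪q X₁ X₂)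
  tr-complete (φ ∨ ψ) (inj₁ x) with tr-complete φ x
  ... | X , r , h = X , r , inj₁ ∘ h
  tr-complete (φ ∨ ψ) (inj₂ x) with tr-complete ψ x
  ... | X , r , h = X , r , inj₂ ∘ h
  -- A run on `t ∷ ts` unfolds to exactly the required triple.
  tr-complete (var p) (_ , x) = x
  tr-complete (⟨ dup ⟩ φ) (_ , dup , x) with tr-complete φ x
  -- The set `Y` found for the tail `t ∷ ts` is the guess; unfolding its run gives the justification
  -- `h` on the copy and the set `X` for `ts`.
  ... | Y , (X , r , h) , g = X , r , λ {X′} X⊆ →
    ⊩-⋁⁺ (λ j → tr φ (subset j) ∧ var (subset j , X′)) {subsetIndex Y}
      (subst (λ Z → _ ⊩[ μ rhs′ ] (tr φ Z ∧ var (Z , X′))) (≡-sym (subset-subsetIndex Y)) (g id , h X⊆))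
  tr-complete (⟨ ↑ α ⟩ φ) (_ , ↑ s , x) with tr-complete φ x
  ... | X , r , h = X , r , λ X⊆ → -, s , h X⊆
  tr-complete (⟨ pop ⟩↓ p) (_ , pop , _ , r) = ⁅ index p ⁆ , r , λ X⊆ → fromWitness (X⊆ (x∈⁅x⁆ _))
  tr-complete (⟨ ↑ α ⟩↓ p) (_ , ↑ s , _ , X , r , h) = X , r , λ X⊆ → -, s , h X⊆

  μ-derived : ∀ p {ts} → μ rhs p ts → Derived p ts
  μ-derived p x = μ-rec {σ = Derived}
    (λ p ts x → let y = fold (⊩-mono (λ _ _ → proj₁) (rhs p) ts x) in y , run p ts x y) p _ x
    where
    run : ∀ p ts → ts ⊩[ Derived ] rhs p → μ rhs p ts → Run ts ⁅ index p ⁆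
    run p []       x y = ⊨-⁅⁆ y
    run p (t ∷ ts) x y with tr-complete (rhs p) x
    ... | X , r , h = X , r , λ X⊆ → fold (rhs′⁺ (λ i∈ → subst (λ p → t ⊩[ μ rhs′ ] tr (rhs p) _)
            (≡-sym (trans (cong elem (x∈⁅y⁆⇒x≡y (index p) i∈)) (elem-index p))) (h X⊆)))


-- Automata for the least solution at every height.

-- Acceptance takes place while the last letter is read. The end of one tree can thus be merged with
-- the entry into the next, without empty moves.
record Automaton (Γ P : Set) : Set₁ where
  field
    State  : Set
    card   : ℕ
    State↪ : State ↪ Fin card
    entry  : P → State
    δ      : State → Bracketed Γ → State → Set
    δ?     : ∀ q b r → Dec (δ q b r)
    last   : State → Bracketed Γ → Set
    last?  : ∀ q b → Dec (last q b)

  infixr 5 _∷_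
  data _⇝_ : State → List (Bracketed Γ) → Set where
    [_] : ∀ {q b} → last q b → q ⇝ (b ∷ [])
    _∷_ : ∀ {q b r u} → δ q b r → r ⇝ u → q ⇝ (b ∷ u)

Captures : ∀ {Γ P n} → Automaton Γ P → Valuation Γ P n → Set
Captures {n = n} A L = ∀ p u → entry p ⇝ u ⇔ (∃ λ t → L p t × yield n t ≡ u)
  where open Automaton A

module Leaves {Γ P : Set} {k l : ℕ} (Γ↪ : Γ ↪ Fin l) (P↪ : P ↪ Fin k) (rhs : P → Formula Γ P 0) where

  step? : ∀ {κ} (α : Act Γ κ 0) a → Dec (∃ λ t → a —[ α ]→ t)
  step? (set b) a = yes (-, set)
  step? (top b) a = map′ (λ { refl → -, top }) (λ { (_ , top) → refl }) (↪-≟ Γ↪ a b)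

  open Saturation P↪ Γ↪ id id (λ _ _ → -, refl) step?

  last : P → Bracketed Γ → Set
  last p (sym a) = μ rhs p a
  last p ⟦       = ⊥
  last p ⟧       = ⊥

  last? : ∀ p b → Dec (last p b)
  last? p (sym a) = μ? rhs p a
  last? p ⟦       = no id
  last? p ⟧       = no id

  automaton : Automaton Γ P
  automaton = record
    { State = P ; State↪ = P↪ ; entry = id
    ; δ = λ _ _ _ → ⊥ ; δ? = λ _ _ _ → no id ; last = last ; last? = last? }

  open Automaton automaton using (_⇝_; [_])

  captures : Captures automaton (μ rhs)
  captures p u = mk⇔ sound (λ { (_ , x , refl) → [ x ] })
    where
    sound : ∀ {u} → p ⇝ u → ∃ λ a → μ rhs p a × sym a ∷ [] ≡ u
    sound ([_] {b = sym a} x) = a , x , refl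

module Nodes {Γ P : Set} {n k l : ℕ} (Γ↪ : Γ ↪ Fin l) (P↪ : P ↪ Fin k) (rhs : P → Formula Γ P (suc n))
  (A′ : Automaton Γ (Descent.P′ P↪ rhs)) (A′-captures : Captures A′ (μ (Descent.rhs′ P↪ rhs)))
  where

  open RightInverse P↪ renaming (to to index; from to elem; strictlyInverseʳ to elem-index)
  open Descent P↪ rhs
  module A′ = Automaton A′

  step[]? : ∀ {κ} (α : Act Γ κ (suc n)) → Dec (∃ λ t → [] —[ α ]→ t)
  step[]? dup   = no λ ()
  step[]? nil   = yes (-, nil)
  step[]? pop   = no λ ()
  step[]? (↑ α) = no λ ()

  []-closed : ∀ {κ} (α : Act Γ κ (suc n)) {t} → [] —[ α ]→ t → ∃ λ (_ : ⊤) → t ≡ []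
  []-closed nil nil = tt , refl

  open Saturation {n = suc n} P↪ (mk↪ {to = λ _ → zero {0}} {from = λ _ → tt} (λ _ → refl)) (λ _ → []) (λ _ → refl)
    (λ α → []-closed α) (λ α _ → step[]? α)

  []⊨? : ∀ Y → Dec ([] ⊨ Y)
  []⊨? Y = map′ (λ h {i} → h i) (λ h i → h) (Fin.all? λ i → (i ∈? Y) →-dec μ? rhs (elem i) tt)

  State : Set
  State = P ⊎ P′ × A′.State ⊎ Subset k

  -- inside Y X s: scanning a tree at state s of A′, having guessed the pair
  -- (Y , X); close Y: all trees were scanned and [] has to satisfy Y.
  pattern start p      = inj₁ p
  pattern inside Y X s = inj₂ (inj₁ ((Y , X) , s))
  pattern close Y      = inj₂ (inj₂ Y)

  _≟ₛ_ : DecidableEquality (Subset k)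
  _≟ₛ_ = ↪-≟ (proj₂ (Subset↪ k))

  _≟ₐ_ : DecidableEquality A′.State
  _≟ₐ_ = ↪-≟ A′.State↪

  -- `Y` is what the rest of the list has to satisfy. Entering guesses either that another tree
  -- follows, together with the set `X` for the list after it, or that the list ends.
  Enter : Subset k → State → Set
  Enter Y (start p)      = ⊥
  Enter Y (inside Z X s) = Y ≡ Z × s ≡ A′.entry (Z , X)
  Enter Y (close Z)      = Y ≡ Z

  Enter? : ∀ Y q → Dec (Enter Y q)
  Enter? Y (start p)      = no id
  Enter? Y (inside Z X s) = Y ≟ₛ Z ×-dec s ≟ₐ A′.entry (Z , X)
  Enter? Y (close Z)      = Y ≟ₛ Z

  Stay : P′ × A′.State → Bracketed Γ → State → Set
  Stay q             b (start p)         = ⊥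
  Stay ((Y , X) , s) b (inside Y′ X′ s′) = Y ≡ Y′ × X ≡ X′ × A′.δ s b s′
  Stay q             b (close Z)         = ⊥

  Stay? : ∀ q b r → Dec (Stay q b r)
  Stay? q             b (start p)         = no id
  Stay? ((Y , X) , s) b (inside Y′ X′ s′) = Y ≟ₛ Y′ ×-dec X ≟ₛ X′ ×-dec A′.δ? s b s′
  Stay? q             b (close Z)         = no id

  δ : State → Bracketed Γ → State → Set
  δ (start p)      ⟦ r = Enter ⁅ index p ⁆ r
  δ (start p)      _ r = ⊥
  δ (inside Y X s) b r = A′.last s b × Enter X r ⊎ Stay ((Y , X) , s) b r
  δ (close Y)      b r = ⊥

  δ? : ∀ q b r → Dec (δ q b r)
  δ? (start p)      (sym a) r = no id
  δ? (start p)      ⟦ r       = Enter? ⁅ index p ⁆ r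
  δ? (start p)      ⟧ r       = no id
  δ? (inside Y X s) b r       = (A′.last? s b ×-dec Enter? X r) ⊎-dec Stay? ((Y , X) , s) b r
  δ? (close Y)      b r       = no id

  last : State → Bracketed Γ → Set
  last (close Y) ⟧ = [] ⊨ Y
  last _         _ = ⊥

  last? : ∀ q b → Dec (last q b)
  last? (start p)      b       = no id
  last? (inside Y X s) b       = no id
  last? (close Y)      (sym a) = no id
  last? (close Y)      ⟦       = no id
  last? (close Y)      ⟧       = []⊨? Y

  automaton : Automaton Γ P
  automaton = record
    { State = State
    ; State↪ = proj₂ (↪-⊎ P↪ (proj₂ (↪-⊎ (proj₂ (↪-× (proj₂ P′↪) A′.State↪)) (proj₂ (Subset↪ k)))))
    ; entry = start ; δ = δ ; δ? = δ? ; last = last ; last? = last? }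

  open Automaton automaton using (_⇝_; [_]; _∷_)

  scan : ∀ {Y X s u v r} → s A′.⇝ u → Enter X r → r ⇝ v → inside Y X s ⇝ (u ++ v)
  scan A′.[ x ]    e a = inj₁ (x , e) ∷ a
  scan (d A′.∷ a′) e a = inj₂ (refl , refl , d) ∷ scan a′ e a

  Run⇒⇝ : ∀ ts {Y} → Run ts Y → ∃ λ r → Enter Y r × r ⇝ yields n ts
  Run⇒⇝ []       x = close _ , refl , [ x ]
  Run⇒⇝ (t ∷ ts) {Y} (X , x , h) with Run⇒⇝ ts x
  ... | r , e , a = inside Y X _ , (refl , refl) ,
    -- `h id` takes the upward closed condition at `X` itself, the set that the automaton guesses.
    scan (Equivalence.from (A′-captures _ _) (t , h id , refl)) e a

  -- Built from the end of the word: the list after the first tree satisfies `X`, and `μ′-sound`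
  -- turns this into `Y` for the whole list. `unscan` finds where the first tree stops, at the
  -- transition that uses `A′.last`.
  ⇝⇒⊨ : ∀ {Y r w} → Enter Y r → r ⇝ w → ∃ λ ts → ts ⊨ Y × yields n ts ≡ w
  unscan : ∀ {Y X s w} → inside Y X s ⇝ w →
    ∃₂ λ u ts → s A′.⇝ u × ts ⊨ X × u ++ yields n ts ≡ w

  ⇝⇒⊨ {r = inside Y X _} (refl , refl) a with unscan a
  ... | u , ts , a′ , h , eq with Equivalence.to (A′-captures (Y , X) u) a′
  ...   | t , x , refl = t ∷ ts , μ′-sound (Y , X) x ts h , eq
  ⇝⇒⊨ {r = close Y} refl ([_] {b = ⟧} x) = [] , x , refl

  unscan (inj₁ (x , e) ∷ a) with ⇝⇒⊨ e a
  ... | ts , h , eq = -, ts , A′.[ x ] , h , cong (_ ∷_) eq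
  unscan (_∷_ {r = inside _ _ _} (inj₂ (refl , refl , d)) a) with unscan a
  ... | _ , ts , a′ , h , eq = -, ts , d A′.∷ a′ , h , cong (_ ∷_) eq

  captures : Captures automaton (μ rhs)
  captures p u = mk⇔ sound complete
    where
    sound : ∀ {u} → start p ⇝ u → ∃ λ ts → μ rhs p ts × ⟦ ∷ yields n ts ≡ u
    sound (_∷_ {b = ⟦} e a) with ⇝⇒⊨ e a
    ... | ts , h , eq = ts , ⊨-index h (x∈⁅x⁆ _) , cong (⟦ ∷_) eq

    complete : ∀ {u} → (∃ λ ts → μ rhs p ts × ⟦ ∷ yields n ts ≡ u) → start p ⇝ u
    complete (ts , x , refl) with Run⇒⇝ ts (proj₂ (μ-derived p x))
    ... | r , e , a = e ∷ a

-- The predicate type varies in the induction, since each level replaces it by pairs of its subsets.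
capture : ∀ {Γ l} → Γ ↪ Fin l → ∀ n {P k} → P ↪ Fin k → (rhs : P → Formula Γ P n) →
  ∃ λ (A : Automaton Γ P) → Captures A (μ rhs)
capture Γ↪ zero    P↪ rhs = -, Leaves.captures Γ↪ P↪ rhs
capture Γ↪ (suc n) P↪ rhs = -, Nodes.captures Γ↪ P↪ rhs A′ A′-captures
  where
  open Descent P↪ rhs
  captured = capture Γ↪ n (proj₂ P′↪) rhs′
  A′ = proj₁ captured
  A′-captures = proj₂ captured

-- Conversion to automata with subset-valued transitions.

∈-tabulate : ∀ {n} {Q : Fin n → Set} (Q? : ∀ i → Dec (Q i)) {i} → i ∈ tabulate (λ i → ⌊ Q? i ⌋) ⇔ Q i
∈-tabulate Q? {i} = mk⇔
  (λ i∈ → toWitness (Equivalence.from T-≡ (trans (≡-sym (lookup∘tabulate _ i)) ([]=⇒lookup i∈))))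
  (λ q → lookup⇒[]= i _ (trans (lookup∘tabulate _ i) (Equivalence.to T-≡ (fromWitness q))))

module ToNFA {Γ P : Set} (A : Automaton Γ P) where

  open Automaton A
  open RightInverse State↪ renaming (to to index; from to elem; strictlyInverseʳ to elem-index)

  -- State zero is the accepting sink.
  Edge : Fin (suc card) → Bracketed Γ → Fin (suc card) → Set
  Edge zero    b j       = ⊥
  Edge (suc i) b zero    = last (elem i) b
  Edge (suc i) b (suc j) = δ (elem i) b (elem j)

  Edge? : ∀ i b j → Dec (Edge i b j)
  Edge? zero    b j       = no id
  Edge? (suc i) b zero    = last? (elem i) b
  Edge? (suc i) b (suc j) = δ? (elem i) b (elem j)

  nfa : P → NFA (Bracketed Γ)
  nfa p = record
    { size    = suc card
    ; initial = ⁅ suc (index (entry p)) ⁆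
    ; step    = λ i b → tabulate λ j → ⌊ Edge? i b j ⌋
    ; final   = ⁅ zero ⁆
    }

  module _ (p : P) where

    edge⁺ : ∀ i b {j} → Edge i b j → j ∈ NFA.step (nfa p) i b
    edge⁺ i b = Equivalence.from (∈-tabulate (Edge? i b))

    edge⁻ : ∀ i b {j} → j ∈ NFA.step (nfa p) i b → Edge i b j
    edge⁻ i b = Equivalence.to (∈-tabulate (Edge? i b))

    acceptsFrom⁺ : ∀ {q u} → q ⇝ u → AcceptsFrom (nfa p) (suc (index q)) u
    acceptsFrom⁺ {q} ([_] {b = b} x) = zero ,
      edge⁺ (suc (index q)) b (subst (λ q → last q _) (≡-sym (elem-index q)) x) , x∈⁅x⁆ _
    acceptsFrom⁺ {q} (_∷_ {b = b} {r} d a) = suc (index r) ,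
      edge⁺ (suc (index q)) b
        (subst (λ q → δ q _ _) (≡-sym (elem-index q)) (subst (δ q _) (≡-sym (elem-index r)) d)) ,
      acceptsFrom⁺ a

    acceptsFrom⁻ : ∀ {i} u → AcceptsFrom (nfa p) (suc i) u → elem i ⇝ u
    acceptsFrom⁻ [] x = contradiction (x∈⁅y⁆⇒x≡y zero x) λ ()
    acceptsFrom⁻ {i} (b ∷ []) (zero , x , _) = [ edge⁻ (suc i) b x ]
    -- The sink has no outgoing edges, so it can only be reached with the last letter.
    acceptsFrom⁻ (b ∷ c ∷ u) (zero , x , _ , y , _) = contradiction (edge⁻ zero c y) id
    acceptsFrom⁻ {i} (b ∷ u) (suc j , d , a) = edge⁻ (suc i) b d ∷ acceptsFrom⁻ u a

    accepts⇔⇝ : ∀ u → Accepts (nfa p) u ⇔ entry p ⇝ u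
    accepts⇔⇝ u = mk⇔
      (λ { (i , i∈ , a) → subst (_⇝ u) (elem-index (entry p)) (acceptsFrom⁻ u
             (subst (λ i → AcceptsFrom (nfa p) i u) (x∈⁅y⁆⇒x≡y _ i∈) a)) })
      (λ a → -, x∈⁅x⁆ _ , acceptsFrom⁺ a)

-- Unique readability, and stores as trees.

yield-≢-⟧ : ∀ {Γ : Set} n (t : Tree Γ n) {u v} → ⟧ ∷ u ≡ yield n t ++ v → ⊥
yield-≢-⟧ zero    t ()
yield-≢-⟧ (suc n) t ()

-- The remainders `u` and `u′` carry the induction through concatenations: a list ends at the first
-- closing bracket where a tree could start.
yield-injective : ∀ {Γ : Set} n (t t′ : Tree Γ n) {u u′} →
  yield n t ++ u ≡ yield n t′ ++ u′ → t ≡ t′ × u ≡ u′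
yields-injective : ∀ {Γ : Set} n (ts ts′ : List (Tree Γ n)) {u u′} →
  yields n ts ++ u ≡ yields n ts′ ++ u′ → ts ≡ ts′ × u ≡ u′
yield-injective zero    t t′ refl = refl , refl
yield-injective (suc n) t t′ eq = yields-injective n t t′ (∷-injectiveʳ eq)
yields-injective n [] [] eq = refl , ∷-injectiveʳ eq
yields-injective n [] (t ∷ ts) eq = ⊥-elim (yield-≢-⟧ n t (trans eq (++-assoc (yield n t) _ _)))
yields-injective n (t ∷ ts) [] eq = ⊥-elim (yield-≢-⟧ n t (trans (≡-sym eq) (++-assoc (yield n t) _ _)))
yields-injective n (t ∷ ts) (t′ ∷ ts′) eq
  with yield-injective n t t′ (trans (≡-sym (++-assoc (yield n t) _ _)) (trans eq (++-assoc (yield n t′) _ _)))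
... | refl , eq′ with yields-injective n ts ts′ eq′
...   | refl , eq″ = refl , eq″

embed : ∀ {Γ : Set} n → Store Γ (suc n) → Tree Γ (suc n)
embed zero    as       = as
embed (suc n) (s ∷ ss) = embed n s ∷ map (embed n) ss

embed-injective : ∀ {Γ : Set} n {s s′ : Store Γ (suc n)} → embed n s ≡ embed n s′ → s ≡ s′
embed-injective zero eq = eq
embed-injective (suc n) {_ ∷ _} {_ ∷ _} eq =
  cong₂ _∷_ (embed-injective n (∷-injectiveˡ eq)) (map-injective (embed-injective n) (∷-injectiveʳ eq))

yield-embed : ∀ {Γ : Set} n (s : Store Γ (suc n)) → yield (suc n) (embed n s) ≡ word (suc n) s
yield-embed zero as = cong (⟦ ∷_) (letters as)
  where
  letters : ∀ as → yields 0 as ≡ map sym as ++ ⟧ ∷ []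
  letters []       = refl
  letters (a ∷ as) = cong (sym a ∷_) (letters as)
yield-embed (suc n) (s ∷ ss) = cong (⟦ ∷_) (stores (s ∷ ss))
  where
  stores : ∀ ss → yields (suc n) (map (embed n) ss) ≡ concatMap (word (suc n)) ss ++ ⟧ ∷ []
  stores []       = refl
  stores (s ∷ ss) = trans (cong₂ _++_ (yield-embed n s) (stores ss)) (≡-sym (++-assoc (word (suc n) s) _ _))

-- Shows that a tree whose yield is accepted comes from a store, which rules out trees with
-- forbidden empty lists.
word≡yield⇒embed : ∀ {Γ : Set} n {s : Store Γ (suc n)} {t} → word (suc n) s ≡ yield (suc n) t → t ≡ embed n s
word≡yield⇒embed n {s} {t} eq = ≡-sym (proj₁ (yield-injective (suc n) (embed n s) t
  (cong (_++ []) (trans (yield-embed n s) eq))))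

-- Actions below the top level.

at : ∀ {Γ κ m n} → Act Γ κ m → m ≤′ n → Act Γ κ n
at α ≤′-refl     = α
at α (≤′-step k) = ↑ (at α k)

-- The tails passed on the way down to the topmost subtree of height `m`. The index is the descent
-- that `at` follows too.
data Ctx (Γ : Set) {m : ℕ} : ∀ {n} → m ≤′ n → Set where
  •   : Ctx Γ ≤′-refl
  _▸_ : ∀ {n} {k : m ≤′ n} → Ctx Γ k → List (Tree Γ n) → Ctx Γ (≤′-step k)

plug : ∀ {Γ m n} {k : m ≤′ n} → Ctx Γ k → Tree Γ m → Tree Γ n
plug •        s = s
plug (c ▸ ts) s = plug c s ∷ ts

plug-injective : ∀ {Γ m n} {k : m ≤′ n} (c c′ : Ctx Γ k) {s s′} → plug c s ≡ plug c′ s′ → c ≡ c′ × s ≡ s′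
plug-injective •        •          eq = refl , eq
plug-injective (c ▸ ts) (c′ ▸ ts′) eq with ∷-injective eq
... | eq₁ , refl with plug-injective c c′ eq₁
...   | refl , eq₂ = refl , eq₂

plug-step : ∀ {Γ κ m n} {k : m ≤′ n} {α : Act Γ κ m} (c : Ctx Γ k) {s s′} →
  s —[ α ]→ s′ → plug c s —[ at α k ]→ plug c s′
plug-step •        x = x
plug-step (c ▸ ts) x = ↑ (plug-step c x)

unplug-step : ∀ {Γ κ m n} (k : m ≤′ n) {α : Act Γ κ m} {t t′} → t —[ at α k ]→ t′ →
  ∃ λ (c : Ctx Γ k) → ∃₂ λ s s′ → t ≡ plug c s × t′ ≡ plug c s′ × s —[ α ]→ s′
unplug-step ≤′-refl     x     = • , -, -, refl , refl , x
unplug-step (≤′-step k) (↑ x) with unplug-step k x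
... | c , s , s′ , refl , refl , y = c ▸ _ , s , s′ , refl , refl , y

inner : ∀ {m n} → suc m ≤′ n → m ≤′ n
inner ≤′-refl     = ≤′-step ≤′-refl
inner (≤′-step k) = ≤′-step (inner k)

infixl 6 _↓_
-- `▸` extends a context at the outside; this extends it at the hole, from a list to its first
-- element.
_↓_ : ∀ {Γ m n} {k : suc m ≤′ n} → Ctx Γ k → List (Tree Γ m) → Ctx Γ (inner k)
•        ↓ us = • ▸ us
(c ▸ ts) ↓ us = (c ↓ us) ▸ ts

plug-↓ : ∀ {Γ m n} {k : suc m ≤′ n} (c : Ctx Γ k) {u us} → plug (c ↓ us) u ≡ plug c (u ∷ us)
plug-↓ •        = refl
plug-↓ (c ▸ ts) = cong (_∷ ts) (plug-↓ c)

-- Automaton runs expressed by formulas.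

module _ {A : Set} (M : NFA A) where
  open NFA M

  Path : Fin size → List A → Fin size → Set
  Path q []      r = q ≡ r
  Path q (a ∷ u) r = ∃ λ s → s ∈ step q a × Path s u r

  Path-++⁺ : ∀ {q r s} u {v} → Path q u r → Path r v s → Path q (u ++ v) s
  Path-++⁺ []      refl        y = y
  Path-++⁺ (a ∷ u) (s , d , x) y = s , d , Path-++⁺ u x y

  Path-++⁻ : ∀ {q s} u {v} → Path q (u ++ v) s → ∃ λ r → Path q u r × Path r v s
  Path-++⁻ []      x           = -, refl , x
  Path-++⁻ (a ∷ u) (s , d , x) with Path-++⁻ u x
  ... | r , y , z = r , (s , d , y) , z

  Path⇒AcceptsFrom : ∀ u {q r} → Path q u r → r ∈ final → AcceptsFrom M q u
  Path⇒AcceptsFrom []      refl        f = f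
  Path⇒AcceptsFrom (a ∷ u) (s , d , x) f = s , d , Path⇒AcceptsFrom u x f

  AcceptsFrom⇒Path : ∀ u {q} → AcceptsFrom M q u → ∃ λ r → Path q u r × r ∈ final
  AcceptsFrom⇒Path []      f = -, refl , f
  AcceptsFrom⇒Path (a ∷ u) (s , d , x) with AcceptsFrom⇒Path u x
  ... | r , y , f = r , (s , d , y) , f

-- Simulates M on the word of the tree by destroying it from the top: ι k q r
-- says that M can go from q to r while it reads the topmost list of height k,
-- without the opening bracket of the list.
module Simulation {Γ P : Set} {n l : ℕ} (Γ↪ : Γ ↪ Fin l) (M : NFA (Bracketed Γ))
  (ι : ∀ {m} → suc m ≤′ suc n → Fin (NFA.size M) → Fin (NFA.size M) → P)
  where

  open NFA M
  open RightInverse Γ↪ renaming (to to index; from to letter; strictlyInverseʳ to letter-index)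

  readTree : ∀ {m} → m ≤′ suc n → Fin size → Fin size → Formula Γ P (suc n)
  readTree {zero}  k q r = ⋁ λ i → test ⌊ r ∈? step q (sym (letter i)) ⌋ ∧ ⟨ at (top (letter i)) k ⟩ test true
  readTree {suc m} k q r = ⋁ λ s → test ⌊ s ∈? step q ⟦ ⌋ ∧ var (ι k s r)

  -- Both conjuncts start from the same tree: one reads the first element, destroying it in its own
  -- branch, and the other pops it unread and continues at the intermediate state `s`.
  readList : ∀ {m} → suc m ≤′ suc n → Fin size → Fin size → Formula Γ P (suc n)
  readList k q r = ⟨ at nil k ⟩ test ⌊ r ∈? step q ⟧ ⌋ ∨ ⋁ λ s → readTree (inner k) q s ∧ ⟨ at pop k ⟩↓ ι k s r

  accepted : Formula Γ P (suc n)
  accepted = ⋁ λ q → ⋁ λ r → test ⌊ q ∈? initial ⌋ ∧ test ⌊ r ∈? final ⌋ ∧ readTree ≤′-refl q r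

  TreePath : ∀ {m} → m ≤′ suc n → Fin size → Fin size → Tree Γ (suc n) → Set
  TreePath {m} k q r t = ∃₂ λ (c : Ctx Γ k) u → t ≡ plug c u × Path M q (yield m u) r

  ListPath : ∀ {m} → suc m ≤′ suc n → Fin size → Fin size → Tree Γ (suc n) → Set
  ListPath {m} k q r t = ∃₂ λ (c : Ctx Γ k) us → t ≡ plug c us × Path M q (yields m us) r

  module _ {ρ : Valuation Γ P (suc n)}
    (sound : ∀ {m} (k : suc m ≤′ suc n) q r t → ρ (ι k q r) t → ListPath k q r t) where

    readTree-sound : ∀ {m} (k : m ≤′ suc n) q r t → t ⊩[ ρ ] readTree k q r → TreePath k q r t
    readTree-sound {zero} k q r t x
      with ⊩-⋁⁻ (λ i → test ⌊ r ∈? step q (sym (letter i)) ⌋ ∧ ⟨ at (top (letter i)) k ⟩ test true) x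
    ... | i , d , _ , y , _ with unplug-step k y
    ...   | c , _ , _ , eq , _ , top = c , letter i , eq , r , toWitness d , refl
    readTree-sound {suc m} k q r t x with ⊩-⋁⁻ (λ s → test ⌊ s ∈? step q ⟦ ⌋ ∧ var (ι k s r)) x
    ... | s , d , y with sound k s r t y
    ...   | c , us , eq , p = c , us , eq , s , toWitness d , p

    readList-sound : ∀ {m} (k : suc m ≤′ suc n) q r t → t ⊩[ ρ ] readList k q r → ListPath k q r t
    readList-sound k q r t (inj₁ (_ , x , d)) with unplug-step k x
    ... | c , _ , _ , eq , _ , nil = c , [] , eq , r , toWitness d , refl
    readList-sound k q r t (inj₂ x) with ⊩-⋁⁻ (λ s → readTree (inner k) q s ∧ ⟨ at pop k ⟩↓ ι k s r) x
    ... | s , y , t′ , z , w with unplug-step k z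
    ...   | c , (u ∷ us) , _ , refl , refl , pop with sound k s r t′ w | readTree-sound (inner k) q s t y
    ...     | c₁ , us₁ , eq₁ , p₁ | c₂ , u₂ , eq₂ , p₂
      -- Both branches decompose the same tree, so their contexts agree and the paths can be joined.
      with plug-injective c c₁ eq₁ | plug-injective (c ↓ us) c₂ (trans (plug-↓ c) eq₂)
    ...       | refl , refl | refl , refl = c , u ∷ us , refl , Path-++⁺ M (yield _ u) p₂ p₁

    accepted-sound : ∀ t → t ⊩[ ρ ] accepted → Accepts M (yield (suc n) t)
    accepted-sound t x
      with ⊩-⋁⁻ (λ q → ⋁ λ r → test ⌊ q ∈? initial ⌋ ∧ test ⌊ r ∈? final ⌋ ∧ readTree ≤′-refl q r) x
    ... | q , y with ⊩-⋁⁻ (λ r → test ⌊ q ∈? initial ⌋ ∧ test ⌊ r ∈? final ⌋ ∧ readTree ≤′-refl q r) y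
    ...   | r , i , f , z with readTree-sound ≤′-refl q r t z
    ...     | • , u , refl , p = q , toWitness i , Path⇒AcceptsFrom M (yield (suc n) t) p (toWitness f)

  module _ {rhs : P → Formula Γ P (suc n)}
    (rhs-ι : ∀ {m} (k : suc m ≤′ suc n) q r → rhs (ι k q r) ≡ readList k q r) where

    readTree-complete : ∀ {m} (k : m ≤′ suc n) (c : Ctx Γ k) u {q r} → Path M q (yield m u) r →
      plug c u ⊩[ μ rhs ] readTree k q r
    readList-complete : ∀ {m} (k : suc m ≤′ suc n) (c : Ctx Γ k) us {q r} → Path M q (yields m us) r →
      μ rhs (ι k q r) (plug c us)

    readTree-complete {zero} k c a {q} {r} (r , d , refl) =
      ⊩-⋁⁺ (λ i → test ⌊ r ∈? step q (sym (letter i)) ⌋ ∧ ⟨ at (top (letter i)) k ⟩ test true) {index a}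
        (subst (λ a′ → plug c a ⊩[ μ rhs ] (test ⌊ r ∈? step q (sym a′) ⌋ ∧ ⟨ at (top a′) k ⟩ test true))
          (≡-sym (letter-index a)) (fromWitness d , -, plug-step c top , tt))
    readTree-complete {suc m} k c us {q} {r} (s , d , p) =
      ⊩-⋁⁺ (λ s → test ⌊ s ∈? step q ⟦ ⌋ ∧ var (ι k s r)) {s} (fromWitness d , readList-complete k c us p)

    readList-complete k c us {q} {r} p = fold (subst (plug c us ⊩[ μ rhs ]_) (≡-sym (rhs-ι k q r)) (unfolded us p))
      where
      unfolded : ∀ us → Path M q (yields _ us) r → plug c us ⊩[ μ rhs ] readList k q r
      unfolded [] (r , d , refl) = inj₁ (-, plug-step c nil , fromWitness d)
      unfolded (u ∷ us) p with Path-++⁻ M (yield _ u) p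
      ... | s , p₁ , p₂ = inj₂ (⊩-⋁⁺ (λ s → readTree (inner k) q s ∧ ⟨ at pop k ⟩↓ ι k s r) {s}
        ( subst (_⊩[ μ rhs ] readTree (inner k) q s) (plug-↓ c) (readTree-complete (inner k) (c ↓ us) u p₁)
        , -, plug-step c pop , readList-complete k c us p₂))

    accepted-complete : ∀ t → Accepts M (yield (suc n) t) → t ⊩[ μ rhs ] accepted
    accepted-complete t (q , i , x) with AcceptsFrom⇒Path M (yield (suc n) t) x
    ... | r , p , f =
      ⊩-⋁⁺ (λ q → ⋁ λ r → test ⌊ q ∈? initial ⌋ ∧ test ⌊ r ∈? final ⌋ ∧ readTree ≤′-refl q r) {q}
        (⊩-⋁⁺ (λ r → test ⌊ q ∈? initial ⌋ ∧ test ⌊ r ∈? final ⌋ ∧ readTree ≤′-refl q r) {r}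
          (fromWitness i , fromWitness f , readTree-complete ≤′-refl • t p))

-- Store operations expressed by formulas.

order₁ : ∀ n → 1 ≤′ suc n
order₁ zero    = ≤′-refl
order₁ (suc n) = ≤′-step (order₁ n)

Effect : ∀ {Γ n} → Op Γ (suc n) → Tree Γ (suc n) → Tree Γ (suc n) → Set
Effect {Γ} {n} (push₁ w) t t′ =
  ∃ λ (c : Ctx Γ (order₁ n)) → ∃₂ λ a us → t ≡ plug c (a ∷ us) × t′ ≡ plug c (w ++ us)
Effect (push (suc _) _ k) t t′ = t —[ at dup k ]→ t′
Effect (pop (suc _) _ k)  t t′ = t —[ at pop k ]→ t′

module _ {Γ P : Set} {n : ℕ} where

  -- The topmost letter becomes the last letter of b ∷ w, on top of which the
  -- others are produced by duplicating and overwriting.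
  write : Γ → List Γ → Formula Γ P (suc n) → Formula Γ P (suc n)
  write b []      φ = ⟨ at (↑ (set b)) (order₁ n) ⟩ φ
  write b (c ∷ w) φ = write c w (⟨ at dup (order₁ n) ⟩ ⟨ at (↑ (set b)) (order₁ n) ⟩ φ)

  -- The continuation is a predicate because two cases shrink: popping, and pushing the empty word,
  -- which removes the topmost letter.
  operate : Op Γ (suc n) → P → Formula Γ P (suc n)
  operate (push₁ [])          p = ⟨ at pop (order₁ n) ⟩↓ p
  operate (push₁ (b ∷ w))     p = write b w (var p)
  operate (push (suc _) _ k)  p = ⟨ at dup k ⟩ var p
  operate (pop (suc _) _ k)   p = ⟨ at pop k ⟩↓ p

  module _ {ρ : Valuation Γ P (suc n)} where

    write⁺ : ∀ (c : Ctx Γ (order₁ n)) b w φ {a us} →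
      plug c (b ∷ w ++ us) ⊩[ ρ ] φ → plug c (a ∷ us) ⊩[ ρ ] write b w φ
    write⁺ c b []      φ x = -, plug-step c (↑ set) , x
    write⁺ c b (d ∷ w) φ x = write⁺ c d w _ (-, plug-step c dup , -, plug-step c (↑ set) , x)

    write⁻ : ∀ b w φ t → t ⊩[ ρ ] write b w φ →
      ∃ λ (c : Ctx Γ (order₁ n)) → ∃₂ λ a us → t ≡ plug c (a ∷ us) × plug c (b ∷ w ++ us) ⊩[ ρ ] φ
    write⁻ b [] φ t (_ , s , x) with unplug-step (order₁ n) s
    ... | c , a ∷ us , _ , refl , refl , ↑ set = c , a , us , refl , x
    write⁻ b (d ∷ w) φ t x with write⁻ d w _ t x
    ... | c , a , us , eq , _ , s , _ , s′ , y with unplug-step (order₁ n) s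
    ...   | c₁ , _ , _ , eq₁ , refl , dup with plug-injective c c₁ eq₁ | unplug-step (order₁ n) s′
    ...     | refl , refl | c₂ , _ , _ , eq₂ , refl , ↑ set with plug-injective c c₂ eq₂
    ...       | refl , refl = c , a , us , eq , y

  module _ {ρ : Valuation Γ P (suc n)} where

    operate⁺ : ∀ o {p t t′} → Effect o t t′ → ρ p t′ → t ⊩[ ρ ] operate o p
    operate⁺ (push₁ [])         (c , a , us , refl , refl) x = -, plug-step c pop , x
    operate⁺ (push₁ (b ∷ w))    (c , a , us , refl , refl) x = write⁺ c b w _ x
    operate⁺ (push (suc _) _ k) s x = -, s , x
    operate⁺ (pop (suc _) _ k)  s x = -, s , x

    operate⁻ : ∀ o {p} t → t ⊩[ ρ ] operate o p → ∃ λ t′ → Effect o t t′ × ρ p t′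
    operate⁻ (push₁ []) t (_ , s , x) with unplug-step (order₁ n) s
    ... | c , a ∷ us , _ , eq , eq′ , pop = -, (c , a , us , eq , eq′) , x
    operate⁻ (push₁ (b ∷ w)) t x with write⁻ b w _ t x
    ... | c , a , us , eq , y = -, (c , a , us , eq , refl) , y
    operate⁻ (push (suc _) _ k) t x = x
    operate⁻ (pop (suc _) _ k)  t x = x

-- Agreement of store operations with actions on trees.

module _ {Γ : Set} where

  map-≡-just : ∀ {A B : Set} {f : A → B} m {b} → Maybe.map f m ≡ just b → ∃ λ a → m ≡ just a × f a ≡ b
  map-≡-just (just a) refl = a , refl , refl

  top₁⁺ : ∀ n {s : Store Γ (suc n)} {a} → top₁ (suc n) s ≡ just a →
    embed n s —[ at (↑ (top a)) (order₁ n) ]→ embed n s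
  top₁⁺ zero    {a ∷ as} refl = ↑ top
  top₁⁺ (suc n) {s ∷ ss} eq   = ↑ (top₁⁺ n eq)

  top₁⁻ : ∀ n {s : Store Γ (suc n)} {a t} → embed n s —[ at (↑ (top a)) (order₁ n) ]→ t →
    top₁ (suc n) s ≡ just a
  top₁⁻ zero    {a ∷ as} (↑ top) = refl
  top₁⁻ (suc n) {s ∷ ss} (↑ x)   = top₁⁻ n x

  applyPush₁⁺ : ∀ n w {s s′ : Store Γ (suc n)} → applyPush₁ (suc n) w s ≡ just s′ →
    ∃ λ (c : Ctx Γ (order₁ n)) → ∃₂ λ a us → embed n s ≡ plug c (a ∷ us) × embed n s′ ≡ plug c (w ++ us)
  applyPush₁⁺ zero    w {a ∷ as} refl = • , a , as , refl , refl
  applyPush₁⁺ (suc n) w {s ∷ ss} eq with map-≡-just (applyPush₁ (suc n) w s) eq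
  ... | s′ , eq′ , refl with applyPush₁⁺ n w eq′
  ...   | c , a , us , eq₁ , eq₂ = c ▸ map (embed n) ss , a , us , cong (_∷ _) eq₁ , cong (_∷ _) eq₂

  applyPush₁⁻ : ∀ n w {s s′ : Store Γ (suc n)} (c : Ctx Γ (order₁ n)) {a us} →
    embed n s ≡ plug c (a ∷ us) → embed n s′ ≡ plug c (w ++ us) → applyPush₁ (suc n) w s ≡ just s′
  applyPush₁⁻ zero    w • refl refl = refl
  applyPush₁⁻ (suc n) w {s ∷ ss} {s′ ∷ ss′} (c ▸ ts) eq eq′
    rewrite applyPush₁⁻ n w {s} {s′} c (∷-injectiveˡ eq) (∷-injectiveˡ eq′)
    = cong (λ ss → just (s′ ∷ ss)) (map-injective (embed-injective n) (trans (∷-injectiveʳ eq) (≡-sym (∷-injectiveʳ eq′))))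

  applyPush-step : ∀ n {k} (2≤k : 2 ≤ suc k) (k≤n : suc k ≤′ suc n) (s : Store Γ (suc n)) →
    embed n s —[ at dup k≤n ]→ embed n (applyPush (suc n) 2≤k k≤n s)
  applyPush-step zero    (s≤s ()) ≤′-refl
  applyPush-step zero    (s≤s _)  (≤′-step (≤′-reflexive ()))
  applyPush-step (suc n) 2≤k      ≤′-refl       (s ∷ ss) = dup
  applyPush-step (suc n) 2≤k      (≤′-step k≤n) (s ∷ ss) = ↑ (applyPush-step n 2≤k k≤n s)

  applyPop⁺ : ∀ n {k} (2≤k : 2 ≤ suc k) (k≤n : suc k ≤′ suc n) (s : Store Γ (suc n)) {s′} →
    applyPop (suc n) 2≤k k≤n s ≡ just s′ → embed n s —[ at pop k≤n ]→ embed n s′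
  applyPop⁺ zero    (s≤s ()) ≤′-refl
  applyPop⁺ zero    (s≤s _)  (≤′-step (≤′-reflexive ()))
  applyPop⁺ (suc n) 2≤k      ≤′-refl       (s ∷ t ∷ ss) refl = pop
  applyPop⁺ (suc n) 2≤k      (≤′-step k≤n) (s ∷ ss)     eq
    with map-≡-just (applyPop (suc n) 2≤k k≤n s) eq
  ... | s′ , eq′ , refl = ↑ (applyPop⁺ n 2≤k k≤n s eq′)

  -- Trees allow the last element of a list to be popped, but the result does
  -- not embed a store.
  applyPop⁻ : ∀ n {k} (2≤k : 2 ≤ suc k) (k≤n : suc k ≤′ suc n) (s : Store Γ (suc n)) {s′ t} →
    embed n s —[ at pop k≤n ]→ t → t ≡ embed n s′ → applyPop (suc n) 2≤k k≤n s ≡ just s′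
  applyPop⁻ zero    (s≤s ()) ≤′-refl
  applyPop⁻ zero    (s≤s _)  (≤′-step (≤′-reflexive ()))
  applyPop⁻ (suc n) 2≤k      ≤′-refl       (s ∷ [])     {_ ∷ _}   pop ()
  applyPop⁻ (suc n) 2≤k      ≤′-refl       (s ∷ t ∷ ss) {s′}      pop eq = cong just (embed-injective (suc n) {t ∷ ss} eq)
  applyPop⁻ (suc n) 2≤k      (≤′-step k≤n) (s ∷ ss)     {s′ ∷ ss′} (↑ x) eq
    rewrite applyPop⁻ n 2≤k k≤n s {s′} x (∷-injectiveˡ eq)
    = cong (λ ss → just (s′ ∷ ss)) (map-injective (embed-injective n) (∷-injectiveʳ eq))

  apply⁺ : ∀ n (o : Op Γ (suc n)) {s s′} → apply (suc n) o s ≡ just s′ → Effect o (embed n s) (embed n s′)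
  apply⁺ n (push₁ w)              eq   = applyPush₁⁺ n w eq
  apply⁺ n (push (suc _) 2≤k k≤n) refl = applyPush-step n 2≤k k≤n _
  apply⁺ n (pop (suc _) 2≤k k≤n)  eq   = applyPop⁺ n 2≤k k≤n _ eq

  apply⁻ : ∀ n (o : Op Γ (suc n)) {s s′} → Effect o (embed n s) (embed n s′) → apply (suc n) o s ≡ just s′
  apply⁻ n (push₁ w)              (c , a , us , eq , eq′) = applyPush₁⁻ n w c eq eq′
  -- `applyPush` is total and yields a `dup` step, so determinism identifies the two results.
  apply⁻ n (push (suc _) 2≤k k≤n) x =
    cong just (embed-injective n (→-deterministic (applyPush-step n 2≤k k≤n _) x))
  apply⁻ n (pop (suc _) 2≤k k≤n)  x = applyPop⁻ n 2≤k k≤n _ x refl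

-- The system for constrained reachability.

Height : ℕ → Set
Height n = ∃ λ m → suc m ≤′ n

Height↪ : ∀ n → Height n ↪ Fin n
Height↪ n = mk↪ {to = to} {from = from n} λ { {l} refl → from-to l }
  where
  to : ∀ {n} → Height n → Fin n
  to (m , ≤′-refl)   = zero
  to (m , ≤′-step k) = suc (to (m , k))

  from : ∀ n → Fin n → Height n
  from (suc n) zero    = n , ≤′-refl
  from (suc n) (suc i) = Product.map₂ ≤′-step (from n i)

  from-to : ∀ {n} (l : Height n) → from n (to l) ≡ l
  from-to (m , ≤′-refl)           = refl
  from-to {suc n} (m , ≤′-step k) = cong (Product.map₂ ≤′-step) (from-to (m , k))

module Reachability {Γ : Set} {l} (Γ↪ : Γ ↪ Fin l) (n : ℕ) (H : HCFP Γ (suc n)) (M N : NFA (Bracketed Γ)) where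

  open HCFP H

  Reading : NFA (Bracketed Γ) → Set
  Reading A = Height (suc n) × Fin (NFA.size A) × Fin (NFA.size A)

  Predicate : Set
  Predicate = Bool ⊎ Reading M ⊎ Reading N

  pattern reach       = inj₁ true
  pattern legal       = inj₁ false
  pattern readM k q r = inj₂ (inj₁ ((_ , k) , q , r))
  pattern readN k q r = inj₂ (inj₂ ((_ , k) , q , r))

  Reading↪ : ∀ A → ∃ λ m → Reading A ↪ Fin m
  Reading↪ A = ↪-× (Height↪ _) (proj₂ (↪-× (↪-id _) (↪-id _)))

  Predicate↪ : ∃ λ m → Predicate ↪ Fin m
  Predicate↪ = ↪-⊎ Bool↪ (proj₂ (↪-⊎ (proj₂ (Reading↪ M)) (proj₂ (Reading↪ N))))

  module Target     = Simulation {P = Predicate} Γ↪ M (λ k q r → readM k q r)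
  module Constraint = Simulation {P = Predicate} Γ↪ N (λ k q r → readN k q r)

  rule : Γ × Op Γ (suc n) → Formula Γ Predicate (suc n)
  rule (a , o) = ⟨ at (↑ (top a)) (order₁ n) ⟩ operate o legal

  -- The first disjunct of `reach` is the empty path. For a longer path, `C` is checked at the
  -- source here and at the target by `legal`, a predicate of its own so that a pop can precede it.
  rhs : Predicate → Formula Γ Predicate (suc n)
  rhs reach         = Target.accepted ∨ Constraint.accepted ∧ ⋁ λ i → rule (lookup Δ i)
  rhs legal         = Constraint.accepted ∧ var reach
  rhs (readM k q r) = Target.readList k q r
  rhs (readN k q r) = Constraint.readList k q r

  -- Built from `H` and the two automata alone, before any sets of stores are introduced; this gives
  -- effectiveness.
  constructed : NFA (Bracketed Γ)
  constructed = ToNFA.nfa (proj₁ (capture Γ↪ (suc n) (proj₂ Predicate↪) rhs)) reach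

  module _ (S C : Pred (Store Γ (suc n)) 0ℓ)
    (M-S : Recognizes (suc n) M S) (N-C : Recognizes (suc n) N C) where

    accepted⇒ : ∀ {A} {Q : Pred (Store Γ (suc n)) 0ℓ} t → Recognizes (suc n) A Q → Accepts A (yield (suc n) t) → ∃ λ s → t ≡ embed n s × Q s
    accepted⇒ t A-Q x with Equivalence.to (A-Q _) x
    ... | s , q , eq = s , word≡yield⇒embed n eq , q

    ⇒accepted : ∀ {A} {Q : Pred (Store Γ (suc n)) 0ℓ} {s} → Recognizes (suc n) A Q → Q s → Accepts A (yield (suc n) (embed n s))
    ⇒accepted {s = s} A-Q q = Equivalence.from (A-Q _) (s , q , ≡-sym (yield-embed n s))

    -- `reach` and `legal` require the tree to embed a store. Hence a pop of order at least 2 that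
    -- empties a list never leads to `legal`.
    Meaning : Valuation Γ Predicate (suc n)
    Meaning reach         t = ∃ λ s → t ≡ embed n s × pre* H C S s
    Meaning legal         t = ∃ λ s → t ≡ embed n s × C s × pre* H C S s
    Meaning (readM k q r) t = Target.ListPath k q r t
    Meaning (readN k q r) t = Constraint.ListPath k q r t

    sound : ∀ p t → t ⊩[ Meaning ] rhs p → Meaning p t
    sound reach t (inj₁ x) with accepted⇒ t M-S (Target.accepted-sound {ρ = Meaning} (λ _ _ _ _ → id) t x)
    ... | s , eq , s∈S = s , eq , s , s∈S , ε
    sound reach t (inj₂ (x , y))
      with accepted⇒ t N-C (Constraint.accepted-sound {ρ = Meaning} (λ _ _ _ _ → id) t x) | ⊩-⋁⁻ (λ i → rule (lookup Δ i)) y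
    -- Testing the top letter changes nothing; determinism identifies the tree after the test with
    -- `embed n s`.
    ... | s , refl , s∈C | i , _ , z , w with top₁⁻ n z | →-deterministic z (top₁⁺ n (top₁⁻ n z))
    ...   | top≡ | refl with operate⁻ (proj₂ (lookup Δ i)) (embed n s) w
    ...     | _ , e , s₁ , refl , s₁∈C , s′ , s′∈S , steps =
      s , refl , s′ , s′∈S , ((-, -, ∈-lookup i , top≡ , apply⁻ n (proj₂ (lookup Δ i)) e) , s∈C , s₁∈C) ◅ steps
    sound legal t (x , s , refl , pre)
      with accepted⇒ t N-C (Constraint.accepted-sound {ρ = Meaning} (λ _ _ _ _ → id) t x)
    ... | s′ , eq , s′∈C = s , refl , subst C (≡-sym (embed-injective n eq)) s′∈C , pre
    sound (readM k q r) t x = Target.readList-sound {ρ = Meaning} (λ _ _ _ _ → id) k q r t x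
    sound (readN k q r) t x = Constraint.readList-sound {ρ = Meaning} (λ _ _ _ _ → id) k q r t x

    complete : ∀ {s s′} → S s′ → Star (StepIn H C) s s′ → μ rhs reach (embed n s)
    complete s∈S ε = fold (inj₁ (Target.accepted-complete (λ _ _ _ → refl) _ (⇒accepted M-S s∈S)))
    complete s∈S (((a , o , ao∈Δ , top≡ , apply≡) , s∈C , s₁∈C) ◅ steps) =
      fold (inj₂ (in-C s∈C , ⊩-⋁⁺ (λ i → rule (lookup Δ i)) {Any.index ao∈Δ}
        (subst (λ r → _ ⊩[ μ rhs ] rule r) (lookup-index ao∈Δ)
          (-, top₁⁺ n top≡ , operate⁺ o (apply⁺ n o apply≡) (fold (in-C s₁∈C , complete s∈S steps))))))
      where
      in-C : ∀ {s} → C s → embed n s ⊩[ μ rhs ] Constraint.accepted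
      in-C s∈C = Constraint.accepted-complete (λ _ _ _ → refl) _ (⇒accepted N-C s∈C)

    recognizes : Recognizes (suc n) constructed (pre* H C S)
    recognizes u = mk⇔
      (λ x → let (t , y , t≡u) = Equivalence.to captured (Equivalence.to accepts x)
                 (s , t≡s , pre) = μ-rec {σ = Meaning} sound reach t y
             in s , pre , trans (≡-sym (yield-embed n s)) (trans (cong (yield (suc n)) (≡-sym t≡s)) t≡u))
      (λ { (s , (s′ , s′∈S , steps) , s≡u) → Equivalence.from accepts (Equivalence.from captured
        (embed n s , complete s′∈S steps , trans (yield-embed n s) s≡u)) })
      where
      automaton = capture Γ↪ (suc n) (proj₂ Predicate↪) rhs
      captured = proj₂ automaton reach u
      accepts = ToNFA.accepts⇔⇝ (proj₁ automaton) reach u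

theorem3 : ∀ {Γ : Set} → Finite Γ → (n : ℕ) → .{{_ : NonZero n}} →
    (∀ (H : HCFP Γ n) (S C : Pred (Store Γ n) 0ℓ) →
    Regular n S → Regular n C → Regular n (pre* H C S))
    ×
    (Σ[ construct ∈ (HCFP Γ n → NFA (Bracketed Γ) → NFA (Bracketed Γ) → NFA (Bracketed Γ)) ]
    (∀ (H : HCFP Γ n) (S C : Pred (Store Γ n) 0ℓ) (M N : NFA (Bracketed Γ)) →
    Recognizes n M S → Recognizes n N C →
    Recognizes n (construct H M N) (pre* H C S)))
theorem3 Γ-finite zero = ⊥-elim (≢-nonZero⁻¹ 0 refl)
theorem3 (_ , Γ↔) (suc n) =
  (λ H S C (M , M-S) (N , N-C) → constructed H M N , recognizes H M N S C M-S N-C) ,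
  constructed , λ H S C M N → recognizes H M N S C
  where open Reachability (↔⇒↪ Γ↔) n
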